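{- For every unary NFA $\mathscr{A}$ with $n$ states there is an equivalent unary NFA (i.e. one with the same language) in Chrobak normal form which has $O(n^2)$ states (with an absolute implied constant) and in which the period of every cycle is at most $n$.
   Context: A unary NFA is a quadruple $\mathscr{A}=(Q,q_0,\delta,F)$ where $Q$ is a finite set of states, $q_0\in Q$ is the initial state, $\delta\subseteq Q\times Q$ is the transition relation, and $F\subseteq Q$ is the set of final states. For $q\in Q$ let $succ(q)=\{q' : (q,q')\in\delta\}$. Since the alphabet is a singleton, the language $L(\mathscr{A})$ is identified with the set of all $x\in\mathbb{N}=\{0,1,2,\ldots\}$ such that there is a path (vertices may repeat) with exactly $x$ transitions from $q_0$ to some state of $F$. Two unary NFAs are equivalent if they have the same language. A unary NFA $(Q,q_0,\delta,F)$ is in Chrobak normal form if $Q$ is the union of $\{q_0,\ldots,q_m\}$ and sets $C_1,\ldots,C_k$, all these sets being pairwise disjoint, such that: (i) for each $1\le i\le k$, $C_i=\{p_{i,0},p_{i,1},\ldots,p_{i,j_i-1}\}$ for some integer $j_i>0$; (ii) for each $0\le i\le m-1$, $succ(q_i)=\{q_{i+1}\}$; (iii) $succ(q_m)=\{p_{1,0},p_{2,0},\ldots,p_{k,0}\}$; (iv) for every $1\le i\le k$ and $0\le h\le j_i-1$, $succ(p_{i,h})=\{p_{i,(h+1 \bmod j_i)}\}$. There is no restriction on the set of final states $F\subseteq Q$. The sets $C_i$ are the cycles, and $j_i$ is the period of the cycle $C_i$. -}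

module Defs where

open import Data.Fin.Base using (Fin; zero; suc; toℕ; fromℕ; inject₁)
open import Data.Nat.Base using (ℕ; zero; suc; NonZero)
open import Data.Nat.DivMod using (_mod_)
open import Data.Product.Base using (Σ; ∃-syntax; _×_; uncurry)
open import Data.Sum.Base using (_⊎_; [_,_]′)
open import Function.Bundles using (_↔_)
open import Function.Definitions using (Bijective)
open import Level using (0ℓ)
open import Relation.Binary.Core using (Rel)
open import Relation.Binary.Definitions using () renaming (Decidable to Decidable₂)
open import Relation.Binary.PropositionalEquality.Core using (_≡_)
open import Relation.Unary using (Pred; Decidable; ｛_｝; _≐_)

-- The sets δ ⊆ Q × Q and F ⊆ Q are decidable predicates, i.e. subsets in the
-- classical sense.
record UnaryNFA : Set₁ where
  field
    Q      : Set
    ∣Q∣    : ℕ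
    finite : Q ↔ Fin ∣Q∣
    q₀     : Q
    δ      : Rel Q 0ℓ
    δ?     : Decidable₂ δ
    F      : Pred Q 0ℓ
    F?     : Decidable F

  succ : Q → Pred Q 0ℓ
  succ q q′ = δ q q′

  data Path : ℕ → Rel Q 0ℓ where
    []  : ∀ {q} → Path zero q q
    _∷_ : ∀ {x q q′ q″} → δ q q′ → Path x q′ q″ → Path (suc x) q q″

  L : Pred ℕ 0ℓ
  L x = ∃[ q ] F q × Path x q₀ q

-- The indices 1, …, k of the cycles are shifted to 0, …, k - 1; k = 0 is allowed.
record ChrobakNormalForm (A : UnaryNFA) : Set where
  open UnaryNFA A
  field
    m k    : ℕ
    period : Fin k → ℕ
    ⦃ period-nonZero ⦄ : ∀ {i} → NonZero (period i)

    q : Fin (suc m) → Q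
    p : (i : Fin k) → Fin (period i) → Q

    -- Surjectivity: the qᵢ and p i h exhaust Q.  Injectivity: they are pairwise
    -- distinct, so that {q₀, …, qₘ}, C₁, …, Cₖ are disjoint and |Cᵢ| = period i.
    bijective : Bijective {A = Fin (suc m) ⊎ Σ (Fin k) (λ i → Fin (period i))}
                          _≡_ _≡_ [ q , uncurry p ]′

    initial : q zero ≡ q₀
    succ-q  : ∀ (i : Fin m) → succ (q (inject₁ i)) ≐ ｛ q (suc i) ｝
    succ-qₘ : succ (q (fromℕ m)) ≐ λ r → ∃[ i ] r ≡ p i (0 mod period i)
    succ-p  : ∀ i (h : Fin (period i)) →
              succ (p i h) ≐ ｛ p i (suc (toℕ h) mod period i) ｝

{-# OPTIONS --safe #-}

-- A long accepting walk runs through a state q lying on a closed walk of some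
-- length ℓ ≤ n.  The parts of the walk before and after q can be shortened
-- without changing their lengths modulo ℓ: as long as one of them has at least
-- nℓ steps, some pair (state, time mod ℓ) repeats, and the steps in between can
-- be cut out.  Both parts then have fewer than n² steps, and repeating the
-- closed walk at q yields accepting walks of every length N ≥ 2n² in the residue
-- class.  Hence a tail of 2n² + 1 states followed by one cycle of each period
-- ℓ = 1, …, n suffices: a cycle state first reached after N steps is final when
-- A has an accepting walk of length N through a state on a closed walk of
-- length ℓ.
module Submission where

open import Defs
open import Data.Empty using (⊥-elim)
open import Data.Fin.Base as Fin using (Fin; zero; suc; toℕ; fromℕ; fromℕ<; inject₁; inject≤; combine)
open import Data.Fin.Properties as Fin using (any?; pigeonhole; combine-injective; +↔⊎)
open import Data.Nat.Base using (ℕ; zero; suc; _+_; _*_; _^_; _∸_; _/_; _%_; _≤_; _<_; z≤n; s≤s; NonZero; >-nonZero)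
open import Data.Nat.DivMod using (_mod_; m%n<n; m≡m%n+[m/n]*n; [m+kn]%n≡m%n; m<n⇒m%n≡m)
open import Data.Nat.Induction using (<-rec)
open import Data.Nat.Properties
open import Data.Nat.Tactic.RingSolver using (solve-∀)
open import Data.Product.Base using (Σ; Σ-syntax; _×_; _,_; ∃; ∃-syntax; proj₁; proj₂)
open import Data.Sum.Base using (_⊎_; inj₁; inj₂)
open import Data.Sum.Function.Propositional using (_⊎-cong_)
open import Function.Base using (_∘_)
open import Function.Bundles using (_↔_; mk↔ₛ′; module Inverse)
open import Function.Construct.Composition using (_↔-∘_)
open import Function.Construct.Identity using (↔-id)
open import Function.Construct.Symmetry using (↔-sym)
open import Function.Properties.Inverse using (↔⇒↣)
open import Relation.Binary.Definitions using (DecidableEquality) renaming (Decidable to Decidable₂)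
open import Relation.Binary.PropositionalEquality using (_≡_; refl; sym; trans; cong; cong₂; subst; subst₂; module ≡-Reasoning)
open import Relation.Nullary.Decidable using (Dec; yes; no; map′; _×-dec_; via-injection)
open import Relation.Unary using (Decidable; _≐_)
open UnaryNFA using (L; ∣Q∣)
open ChrobakNormalForm using (period)

-- Residues modulo a period.

%-≡⇒∸-multiple : ∀ i j ℓ .{{_ : NonZero ℓ}} → i % ℓ ≡ j % ℓ →
                 j ∸ i ≡ (j / ℓ ∸ i / ℓ) * ℓ
%-≡⇒∸-multiple i j ℓ eq = begin
  j ∸ i                                          ≡⟨ cong₂ _∸_ (m≡m%n+[m/n]*n j ℓ) (m≡m%n+[m/n]*n i ℓ) ⟩
  (j % ℓ + j / ℓ * ℓ) ∸ (i % ℓ + i / ℓ * ℓ)      ≡⟨ cong (λ r → (j % ℓ + j / ℓ * ℓ) ∸ (r + i / ℓ * ℓ)) eq ⟩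
  (j % ℓ + j / ℓ * ℓ) ∸ (j % ℓ + i / ℓ * ℓ)      ≡⟨ [m+n]∸[m+o]≡n∸o (j % ℓ) _ _ ⟩
  j / ℓ * ℓ ∸ i / ℓ * ℓ                          ≡⟨ *-distribʳ-∸ ℓ (j / ℓ) (i / ℓ) ⟨
  (j / ℓ ∸ i / ℓ) * ℓ                            ∎
  where open ≡-Reasoning

toℕ-mod : ∀ x ℓ .{{_ : NonZero ℓ}} → toℕ (x mod ℓ) ≡ x % ℓ
toℕ-mod x ℓ = Fin.toℕ-fromℕ< (m%n<n x ℓ)

suc-mod : ∀ x ℓ .{{_ : NonZero ℓ}} → suc (toℕ (x mod ℓ)) mod ℓ ≡ suc x mod ℓ
suc-mod x ℓ = Fin.toℕ-injective (begin
  toℕ (suc (toℕ (x mod ℓ)) mod ℓ)    ≡⟨ toℕ-mod _ ℓ ⟩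
  suc (toℕ (x mod ℓ)) % ℓ            ≡⟨ cong (λ r → suc r % ℓ) (toℕ-mod x ℓ) ⟩
  suc (x % ℓ) % ℓ                    ≡⟨ [m+kn]%n≡m%n (suc (x % ℓ)) (x / ℓ) ℓ ⟨
  (suc (x % ℓ) + x / ℓ * ℓ) % ℓ      ≡⟨ cong (λ r → suc r % ℓ) (m≡m%n+[m/n]*n x ℓ) ⟨
  suc x % ℓ                          ≡⟨ toℕ-mod _ ℓ ⟨
  toℕ (suc x mod ℓ)                  ∎)
  where open ≡-Reasoning

mod-unique : ∀ {ℓ} .{{_ : NonZero ℓ}} (h : Fin ℓ) k → (toℕ h + k * ℓ) mod ℓ ≡ h
mod-unique {ℓ} h k = Fin.toℕ-injective
  (trans (toℕ-mod _ ℓ) (trans ([m+kn]%n≡m%n (toℕ h) k ℓ) (m<n⇒m%n≡m (Fin.toℕ<n h))))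

-- Counting the states on a family of cycles.

Σ-Fin-suc : ∀ {n} (P : Fin (suc n) → Set) → Σ (Fin (suc n)) P ↔ (P zero ⊎ Σ (Fin n) (P ∘ suc))
Σ-Fin-suc P = mk↔ₛ′
  (λ { (zero , y) → inj₁ y ; (suc i , y) → inj₂ (i , y) })
  (λ { (inj₁ y) → zero , y ; (inj₂ (i , y)) → suc i , y })
  (λ { (inj₁ _) → refl ; (inj₂ _) → refl })
  (λ { (zero , _) → refl ; (suc _ , _) → refl })

Σ-Fin-finite : ∀ n {b} (f : Fin n → ℕ) → (∀ i → f i ≤ b) →
               Σ[ N ∈ ℕ ] (Σ (Fin n) (Fin ∘ f) ↔ Fin N) × N ≤ n * b
Σ-Fin-finite zero    f f≤b = 0 , mk↔ₛ′ (λ ()) (λ ()) (λ ()) (λ ()) , z≤n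
Σ-Fin-finite (suc n) f f≤b with Σ-Fin-finite n (f ∘ suc) (f≤b ∘ suc)
... | N , iso , N≤ = f zero + N
                   , ↔-sym +↔⊎ ↔-∘ ((↔-id _ ⊎-cong iso) ↔-∘ Σ-Fin-suc (Fin ∘ f))
                   , +-mono-≤ (f≤b zero) N≤

-- Walks in the given automaton: decidability, cutting and pumping.

module Walks (A : UnaryNFA) where
  open UnaryNFA A hiding (L) renaming (∣Q∣ to n)
  open Inverse finite using (to; from; strictlyInverseʳ)

  to-injective : ∀ {p q} → to p ≡ to q → p ≡ q
  to-injective {p} {q} eq = trans (sym (strictlyInverseʳ p)) (trans (cong from eq) (strictlyInverseʳ q))

  _≟Q_ : DecidableEquality Q
  _≟Q_ = via-injection (↔⇒↣ finite) Fin._≟_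

  -- The final states of the new automaton are defined by the existence of walks in `A`, so `F?`
  -- comes down to searches over the finite set `Q`.
  ∃? : {P : Q → Set} → Decidable P → Dec (∃ P)
  ∃? {P} P? = map′ (λ (i , y) → from i , y)
                   (λ (q , y) → to q , subst P (sym (strictlyInverseʳ q)) y)
                   (any? (P? ∘ from))

  path? : ∀ x → Decidable₂ (Path x)
  path? zero    p r = map′ (λ { refl → [] }) (λ { [] → refl }) (p ≟Q r)
  path? (suc x) p r = map′ (λ (_ , e , w) → e ∷ w) (λ { (e ∷ w) → _ , e , w })
                           (∃? λ q → δ? p q ×-dec path? x q r)

  L? : Decidable (L A)
  L? x = ∃? λ f → F? f ×-dec path? x q₀ f

  n>0 : 0 < n
  n>0 = ≤-<-trans z≤n (Fin.toℕ<n (to q₀))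

  infixr 5 _++_

  _++_ : ∀ {x y p q r} → Path x p q → Path y q r → Path (x + y) p r
  []      ++ v = v
  (e ∷ u) ++ v = e ∷ (u ++ v)

  repeat : ∀ {ℓ q} k → Path ℓ q q → Path (k * ℓ) q q
  repeat zero    w = []
  repeat (suc k) w = w ++ repeat k w

  state : ∀ {x p r} → Path x p r → Fin (suc x) → Q
  state {p = p} w       zero    = p
  state         (_ ∷ w) (suc i) = state w i

  before : ∀ {x p r} (w : Path x p r) i → Path (toℕ i) p (state w i)
  before w       zero    = []
  before (e ∷ w) (suc i) = e ∷ before w i

  after : ∀ {x p r} (w : Path x p r) i → Path (x ∸ toℕ i) (state w i) r
  after w       zero    = w
  after (e ∷ w) (suc i) = after w i

  between : ∀ {x p r} (w : Path x p r) {i j} → i Fin.≤ j →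
            Path (toℕ j ∸ toℕ i) (state w i) (state w j)
  between w       {zero}  {j}     _         = before w j
  between (_ ∷ w) {suc _} {suc _} (s≤s i≤j) = between w i≤j

  -- The first `n * ℓ + 1` times carry only `n * ℓ` labels (state, time mod `ℓ`). Looking at an
  -- initial segment only is what bounds `j`, and later the length of the closed walk.
  recurrence : ∀ ℓ .{{_ : NonZero ℓ}} {x p r} → n * ℓ ≤ x → (w : Path x p r) →
               ∃[ i ] ∃[ j ] i Fin.< j × toℕ j ≤ n * ℓ × state w i ≡ state w j × toℕ i % ℓ ≡ toℕ j % ℓ
  recurrence ℓ {x} nℓ≤x w =
    let i , j , i<j , eq = pigeonhole (n<1+n (n * ℓ)) label
        eqᵠ , eqʳ        = combine-injective _ _ _ _ eq
    in time i , time j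
     , subst₂ _<_ (sym (toℕ-time i)) (sym (toℕ-time j)) i<j
     , subst (_≤ n * ℓ) (sym (toℕ-time j)) (Fin.toℕ≤pred[n] j)
     , to-injective eqᵠ
     , trans (sym (toℕ-mod _ ℓ)) (trans (cong toℕ eqʳ) (toℕ-mod _ ℓ))
    where
    time : Fin (suc (n * ℓ)) → Fin (suc x)
    time i = inject≤ i (s≤s nℓ≤x)
    toℕ-time : ∀ i → toℕ (time i) ≡ toℕ i
    toℕ-time i = Fin.toℕ-inject≤ i (s≤s nℓ≤x)
    label : Fin (suc (n * ℓ)) → Fin (n * ℓ)
    label i = combine (to (state w (time i))) (toℕ (time i) mod ℓ)

  -- Used twice: modulus 1 produces a short closed walk to pump, and a general modulus produces a
  -- closed walk whose removal preserves the length mod `ℓ`.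
  repetition : ∀ ℓ .{{_ : NonZero ℓ}} {x p r} → n * ℓ ≤ x → Path x p r →
               ∃[ a ] ∃[ d ] ∃[ b ] ∃[ q ] 0 < d × d ≤ n × a + (d * ℓ + b) ≡ x ×
               Path a p q × Path (d * ℓ) q q × Path b q r
  repetition ℓ {x} nℓ≤x w with recurrence ℓ nℓ≤x w
  ... | i , j , i<j , j≤nℓ , same , i≡j
    = toℕ i , d , x ∸ toℕ j , state w i
    , n≢0⇒n>0 (λ d≡0 → m>n⇒m∸n≢0 i<j (trans j∸i≡dℓ (cong (_* ℓ) d≡0)))
    -- Cancel `ℓ` in `d * ℓ = j - i ≤ j ≤ n * ℓ`.
    , *-cancelʳ-≤ d n ℓ (≤-trans (≤-reflexive (sym j∸i≡dℓ)) (≤-trans (m∸n≤m (toℕ j) (toℕ i)) j≤nℓ))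
    , (begin
        toℕ i + (d * ℓ + (x ∸ toℕ j))             ≡⟨ +-assoc (toℕ i) _ _ ⟨
        toℕ i + d * ℓ + (x ∸ toℕ j)               ≡⟨ cong (λ z → toℕ i + z + (x ∸ toℕ j)) j∸i≡dℓ ⟨
        toℕ i + (toℕ j ∸ toℕ i) + (x ∸ toℕ j)     ≡⟨ cong (_+ (x ∸ toℕ j)) (m+[n∸m]≡n (<⇒≤ i<j)) ⟩
        toℕ j + (x ∸ toℕ j)                       ≡⟨ m+[n∸m]≡n (Fin.toℕ≤pred[n] j) ⟩
        x                                         ∎)
    , before w i
    , subst₂ (λ t → Path t (state w i)) j∸i≡dℓ (sym same) (between w (<⇒≤ i<j))
    , subst (λ q → Path (x ∸ toℕ j) q _) (sym same) (after w j)
    where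
    open ≡-Reasoning
    d : ℕ
    d = toℕ j / ℓ ∸ toℕ i / ℓ
    j∸i≡dℓ : toℕ j ∸ toℕ i ≡ d * ℓ
    j∸i≡dℓ = %-≡⇒∸-multiple (toℕ i) (toℕ j) ℓ i≡j

  shorten : ∀ ℓ .{{_ : NonZero ℓ}} {p r} x → Path x p r →
            ∃[ y ] ∃[ k ] y + k * ℓ ≡ x × y < n * ℓ × Path y p r
  shorten ℓ {p} {r} = <-rec _ step
    where
    step : ∀ x → (∀ {x′} → x′ < x → Path x′ p r → ∃[ y ] ∃[ k ] y + k * ℓ ≡ x′ × y < n * ℓ × Path y p r) →
           Path x p r → ∃[ y ] ∃[ k ] y + k * ℓ ≡ x × y < n * ℓ × Path y p r
    step x ih w with n * ℓ ≤? x
    ... | no  nℓ≰x = x , 0 , +-identityʳ x , ≰⇒> nℓ≰x , w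
    ... | yes nℓ≤x with repetition ℓ nℓ≤x w
    ...   | a , d , b , q , d>0 , _ , refl , u , _ , v
      -- Bypassing the closed walk leaves `a + b` steps, strictly fewer because `d * ℓ` is positive.
      with ih (+-monoʳ-< a (m<n+m b (≤-trans d>0 (m≤m*n d ℓ)))) (u ++ v)
    ...     | y , k , eq , y<nℓ , w′ = y , k + d , sum , y<nℓ , w′
      where
      open ≡-Reasoning
      distribute : ∀ y k d ℓ → y + (k + d) * ℓ ≡ y + k * ℓ + d * ℓ
      distribute = solve-∀
      insert : ∀ a b c → a + b + c ≡ a + (c + b)
      insert = solve-∀
      sum : y + (k + d) * ℓ ≡ a + (d * ℓ + b)
      sum = begin
        y + (k + d) * ℓ      ≡⟨ distribute y k d ℓ ⟩
        y + k * ℓ + d * ℓ    ≡⟨ cong (_+ d * ℓ) eq ⟩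
        a + b + d * ℓ        ≡⟨ insert a b (d * ℓ) ⟩
        a + (d * ℓ + b)      ∎

  -- The closed walk is attached at `q` but not counted in `N`. Taking the splitting time `a` in
  -- `Fin (suc N)` makes the search finite and the subtraction `N ∸ toℕ a` exact.
  Pumpable : ℕ → ℕ → Set
  Pumpable ℓ N = ∃[ q ] Path ℓ q q × (∃[ a ] Path (toℕ {suc N} a) q₀ q ×
                 (∃[ f ] F f × Path (N ∸ toℕ a) q f))

  pumpable? : ∀ ℓ N → Dec (Pumpable ℓ N)
  pumpable? ℓ N = ∃? λ q → path? ℓ q q ×-dec any? λ a → path? (toℕ a) q₀ q ×-dec
                  ∃? λ f → F? f ×-dec path? (N ∸ toℕ a) q f

  pumpable : ∀ {ℓ q f} a b → Path ℓ q q → Path a q₀ q → F f → Path b q f → Pumpable ℓ (a + b)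
  pumpable {ℓ} {q} {f} a b loop u Ff v
    = q , loop , fromℕ< a<1+a+b
    , subst (λ t → Path t q₀ q) (sym toℕ-a) u
    , f , Ff , subst (λ t → Path t q f) (trans (sym (m+n∸m≡n a b)) (cong (a + b ∸_) (sym toℕ-a))) v
    where
    a<1+a+b : a < suc (a + b)
    a<1+a+b = s≤s (m≤m+n a b)
    toℕ-a : toℕ (fromℕ< a<1+a+b) ≡ a
    toℕ-a = Fin.toℕ-fromℕ< a<1+a+b

  pump : ∀ {ℓ N} → Pumpable ℓ N → ∀ k → L A (N + k * ℓ)
  pump {ℓ} {N} (q , loop , a , u , f , Ff , v) k
    = f , Ff , subst (λ t → Path t q₀ f) sum (u ++ repeat k loop ++ v)
    where
    insert : ∀ a b c → a + (b + c) ≡ a + c + b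
    insert = solve-∀
    sum : toℕ a + (k * ℓ + (N ∸ toℕ a)) ≡ N + k * ℓ
    sum = trans (insert (toℕ a) (k * ℓ) _) (cong (_+ k * ℓ) (m+[n∸m]≡n (Fin.toℕ≤pred[n] a)))

  -- The period depends on `x` alone and is fixed before `N`, so that `N` can later be the time of
  -- the first visit to a state on the cycle of that period.
  long⇒pumpable : ∀ {x} → n ≤ x → L A x →
                  ∃[ ℓ ] 0 < ℓ × ℓ ≤ n × (∀ {N} k → 2 * (n * n) ≤ N → N + k * ℓ ≡ x → Pumpable ℓ N)
  long⇒pumpable {x} n≤x (f , Ff , w) with repetition 1 (subst (_≤ x) (sym (*-identityʳ n)) n≤x) w
  -- Modulo 1 all times agree, so this is a plain repetition of a state, with a closed walk of
  -- length `d ≤ n`.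
  ... | a , d , b , q , d>0 , d≤n , refl , u , loop , v
    = d , d>0 , d≤n , shifted
    where
    instance
      d≢0 : NonZero d
      d≢0 = >-nonZero d>0

    loop′ : Path d q q
    loop′ = subst (λ t → Path t q q) (*-identityʳ d) loop

    shifted : ∀ {N} k → 2 * (n * n) ≤ N → N + k * d ≡ a + (d * 1 + b) → Pumpable d N
    shifted {N} k 2n²≤N N+kd≡x with shorten d a u | shorten d b v
    ... | a′ , i , refl , a′<nd , u′ | b′ , j , refl , b′<nd , v′
      = subst (Pumpable d) N≡ (pumpable a′ (e * d + b′) loop′ u′ Ff (repeat e loop′ ++ v′))
      where
      open ≤-Reasoning
      -- `K` counts the copies of `d` in `x` beyond `a′ + b′`: `i` cut before `q`, `j` cut after it,
      -- and one for the closed walk itself. Going down from `x` to `N` gives up `k` of them, so `e`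
      -- turns remain.
      K e : ℕ
      K = i + suc j
      e = K ∸ k

      collect : ∀ a b i j d → a + i * d + (d * 1 + (b + j * d)) ≡ a + b + (i + suc j) * d
      collect = solve-∀

      twice : ∀ z → z + z ≡ 2 * z
      twice = solve-∀

      a′+b′≤N : a′ + b′ ≤ N
      a′+b′≤N = begin
        a′ + b′          ≤⟨ +-mono-≤ (<⇒≤ a′<nd) (<⇒≤ b′<nd) ⟩
        n * d + n * d    ≤⟨ +-mono-≤ (*-monoʳ-≤ n d≤n) (*-monoʳ-≤ n d≤n) ⟩
        n * n + n * n    ≡⟨ twice (n * n) ⟩
        2 * (n * n)      ≤⟨ 2n²≤N ⟩
        N                ∎

      total : N + k * d ≡ a′ + b′ + K * d
      total = trans N+kd≡x (collect a′ b′ i j d)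

      -- This rules out truncation in `K ∸ k`; it holds because the shortened parts together fit
      -- into `N`.
      kd≤Kd : k * d ≤ K * d
      kd≤Kd = +-cancelˡ-≤ N _ _ (≤-trans (≤-reflexive total) (+-monoˡ-≤ (K * d) a′+b′≤N))

      insert : ∀ a b c → a + (c + b) ≡ a + b + c
      insert = solve-∀

      N≡ : a′ + (e * d + b′) ≡ N
      N≡ = begin-equality
        a′ + (e * d + b′)              ≡⟨ insert a′ b′ (e * d) ⟩
        a′ + b′ + e * d                ≡⟨ cong (a′ + b′ +_) (*-distribʳ-∸ d K k) ⟩
        a′ + b′ + (K * d ∸ k * d)      ≡⟨ +-∸-assoc (a′ + b′) kd≤Kd ⟨
        a′ + b′ + K * d ∸ k * d        ≡⟨ cong (_∸ k * d) total ⟨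
        N + k * d ∸ k * d              ≡⟨ m+n∸n≡m N (k * d) ⟩
        N                              ∎

-- The automaton in Chrobak normal form.

module Construction (A : UnaryNFA) where
  open Walks A using (n>0; Pumpable; pumpable?; pump; long⇒pumpable; L?)
  open UnaryNFA A using () renaming (∣Q∣ to n)

  m : ℕ
  m = 2 * (n * n)

  -- Each length from 1 to `n` serves as a period once, whether or not `A` has a closed walk of that
  -- length.
  ℓ : Fin n → ℕ
  ℓ c = suc (toℕ c)

  State : Set
  State = Fin (suc m) ⊎ Σ (Fin n) (Fin ∘ ℓ)

  Edge : State → State → Set
  Edge (inj₁ i)       (inj₁ j)       = toℕ j ≡ suc (toℕ i)
  Edge (inj₁ i)       (inj₂ (c , h)) = toℕ i ≡ m × h ≡ zero
  Edge (inj₂ (c , h)) y              = y ≡ inj₂ (c , suc (toℕ h) mod ℓ c)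

  -- From the initial state it takes `m` steps to the end of the tail, one to enter the cycle and
  -- `toℕ h` along it, so `suc m + toℕ h` is the time of the first visit.
  Final : State → Set
  Final (inj₁ i)       = L A (toℕ i)
  Final (inj₂ (c , h)) = Pumpable (ℓ c) (suc m + toℕ h)

  cycles : Σ[ N ∈ ℕ ] (Σ (Fin n) (Fin ∘ ℓ) ↔ Fin N) × N ≤ n * n
  cycles = Σ-Fin-finite n ℓ Fin.toℕ<n

  State-finite : State ↔ Fin (suc m + proj₁ cycles)
  State-finite = ↔-sym +↔⊎ ↔-∘ (↔-id _ ⊎-cong proj₁ (proj₂ cycles))

  _≟ˢ_ : DecidableEquality State
  _≟ˢ_ = via-injection (↔⇒↣ State-finite) Fin._≟_

  edge? : Decidable₂ Edge
  edge? (inj₁ i) (inj₁ j)       = toℕ j ≟ suc (toℕ i)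
  edge? (inj₁ i) (inj₂ (c , h)) = toℕ i ≟ m ×-dec h Fin.≟ zero
  edge? (inj₂ _) y              = y ≟ˢ _

  final? : Decidable Final
  final? (inj₁ i)       = L? (toℕ i)
  final? (inj₂ (c , h)) = pumpable? (ℓ c) (suc m + toℕ h)

  B : UnaryNFA
  B = record
    { Q = State ; finite = State-finite ; q₀ = inj₁ zero
    ; δ = Edge ; δ? = edge? ; F = Final ; F? = final? }

  open UnaryNFA B using (Path; []; _∷_)

  B-chrobak : ChrobakNormalForm B
  B-chrobak = record
    { m         = m
    ; k         = n
    ; period    = ℓ
    ; q         = inj₁
    ; p         = λ c h → inj₂ (c , h)
    ; bijective = (λ { {inj₁ _} {inj₁ _} refl → refl ; {inj₂ _} {inj₂ _} refl → refl })
                , (λ { (inj₁ i) → inj₁ i , λ { refl → refl } ; (inj₂ z) → inj₂ z , λ { refl → refl } })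
    ; initial   = refl
    ; succ-q    = λ i → succ-q⇒ i , λ { refl → cong suc (sym (Fin.toℕ-inject₁ i)) }
    ; succ-qₘ   = succ-qₘ⇒ , λ { (c , refl) → Fin.toℕ-fromℕ m , refl }
    ; succ-p    = λ c h → sym , sym
    }
    where
    succ-q⇒ : ∀ (i : Fin m) {y} → Edge (inj₁ (inject₁ i)) y → inj₁ (suc i) ≡ y
    succ-q⇒ i {inj₁ j} eq = cong inj₁ (Fin.toℕ-injective (trans (cong suc (sym (Fin.toℕ-inject₁ i))) (sym eq)))
    succ-q⇒ i {inj₂ _} (eq , _) = ⊥-elim (<-irrefl (trans (sym (Fin.toℕ-inject₁ i)) eq) (Fin.toℕ<n i))

    succ-qₘ⇒ : ∀ {y} → Edge (inj₁ (fromℕ m)) y → ∃[ c ] y ≡ inj₂ (c , 0 mod ℓ c)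
    succ-qₘ⇒ {inj₁ j} eq = ⊥-elim (<-irrefl (trans eq (cong suc (Fin.toℕ-fromℕ m))) (Fin.toℕ<n j))
    succ-qₘ⇒ {inj₂ (c , _)} (_ , refl) = c , refl

  -- Closed form for the times at which a state is reached from the start, `k` being the number of
  -- completed rounds. `at-path` and `path` give the two directions.
  At : ℕ → State → Set
  At t (inj₁ i)       = t ≡ toℕ i
  At t (inj₂ (c , h)) = ∃[ k ] t ≡ suc m + toℕ h + k * ℓ c

  at-step : ∀ {t y z} → At t y → Edge y z → At (suc t) z
  at-step {y = inj₁ i}       {inj₁ j} refl eq          = sym eq
  at-step {y = inj₁ i}       {inj₂ _} refl (eq , refl) = 0 , cong suc (trans eq (pad m))
    where
    pad : ∀ m → m ≡ m + 0 + 0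
    pad = solve-∀
  -- The quotient `h′ / ℓ c` is 1 exactly when the step closes a round and 0 otherwise.
  at-step {y = inj₂ (c , h)} (k , refl) refl = h′ / ℓ c + k , (begin
    suc (suc m + toℕ h + k * ℓ c)                        ≡⟨ shift m (toℕ h) (k * ℓ c) ⟩
    suc m + (h′ + k * ℓ c)                               ≡⟨ cong (λ r → suc m + (r + k * ℓ c)) (m≡m%n+[m/n]*n h′ (ℓ c)) ⟩
    suc m + (h′ % ℓ c + h′ / ℓ c * ℓ c + k * ℓ c)        ≡⟨ regroup (suc m) (h′ % ℓ c) (h′ / ℓ c) k (ℓ c) ⟩
    suc m + h′ % ℓ c + (h′ / ℓ c + k) * ℓ c              ≡⟨ cong (λ r → suc m + r + (h′ / ℓ c + k) * ℓ c) (toℕ-mod h′ (ℓ c)) ⟨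
    suc m + toℕ (h′ mod ℓ c) + (h′ / ℓ c + k) * ℓ c      ∎)
    where
    open ≡-Reasoning
    h′ : ℕ
    h′ = suc (toℕ h)
    shift : ∀ m h z → suc (suc m + h + z) ≡ suc m + (suc h + z)
    shift = solve-∀
    regroup : ∀ s r q k d → s + (r + q * d + k * d) ≡ s + r + (q + k) * d
    regroup = solve-∀

  at-path : ∀ {x t y z} → At t y → Path x y z → At (x + t) z
  at-path at []                = at
  at-path {suc x} {t} {z = z} at (e ∷ w) = subst (λ s → At s z) (+-suc x t) (at-path (at-step at e) w)

  _∷ʳ_ : ∀ {x y z u} → Path x y z → Edge z u → Path (suc x) y u
  []      ∷ʳ e′ = e′ ∷ []
  (e ∷ w) ∷ʳ e′ = e ∷ (w ∷ʳ e′)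

  tail-path : ∀ t (t<1+m : t < suc m) → Path t (inj₁ zero) (inj₁ (fromℕ< t<1+m))
  tail-path zero    (s≤s _) = []
  tail-path (suc t) t<1+m   = tail-path t t<1+m′ ∷ʳ
    trans (Fin.toℕ-fromℕ< t<1+m) (cong suc (sym (Fin.toℕ-fromℕ< t<1+m′)))
    where
    t<1+m′ : t < suc m
    t<1+m′ = <-trans (n<1+n t) t<1+m

  -- Naming the state by `t mod ℓ c` lets the induction run past the end of the cycle without a case
  -- for wrapping around.
  cycle-path : ∀ c t → Path (suc t + m) (inj₁ zero) (inj₂ (c , t mod ℓ c))
  cycle-path c zero    = tail-path m (n<1+n m) ∷ʳ (Fin.toℕ-fromℕ< (n<1+n m) , refl)
  cycle-path c (suc t) = cycle-path c t ∷ʳ cong (λ h → inj₂ (c , h)) (sym (suc-mod t (ℓ c)))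

  path : ∀ {t} z → At t z → Path t (inj₁ zero) z
  path (inj₁ i) refl = subst (λ j → Path (toℕ i) (inj₁ zero) (inj₁ j)) (Fin.fromℕ<-toℕ i _) (tail-path (toℕ i) (Fin.toℕ<n i))
  path (inj₂ (c , h)) (k , refl) =
    subst₂ (λ t j → Path t (inj₁ zero) (inj₂ (c , j))) (reorder (toℕ h) (k * ℓ c) m) (mod-unique h k)
      (cycle-path c (toℕ h + k * ℓ c))
    where
    reorder : ∀ h z m → suc (h + z) + m ≡ suc m + h + z
    reorder = solve-∀

  -- Equality of the languages and the size bound.

  n≤m : n ≤ m
  n≤m = ≤-trans (m≤m*n n n {{>-nonZero n>0}}) (m≤m+n (n * n) _)

  -- Finality of a cycle state speaks of its first visit only. A later visit adds `k` full rounds,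
  -- matched in `A` by `k` turns of the closed walk.
  sound : ∀ {x} → L B x → L A x
  sound {x} (z , Fz , w) = accept z Fz (subst (λ s → At s z) (+-identityʳ x) (at-path {t = 0} refl w))
    where
    accept : ∀ {x} z → Final z → At x z → L A x
    accept (inj₁ i) a  refl       = a
    accept (inj₂ _) pm (k , refl) = pump pm k

  complete : ∀ {x} → L A x → L B x
  complete {x} x∈L with x ≤? m
  ... | yes x≤m = inj₁ (fromℕ< (s≤s x≤m)) , subst (L A) (sym (Fin.toℕ-fromℕ< (s≤s x≤m))) x∈L , tail-path x (s≤s x≤m)
  ... | no  x≰m with long⇒pumpable (≤-trans n≤m (<⇒≤ (≰⇒> x≰m))) x∈L
  ...   | d@(suc d-1) , _ , d≤n , pumpable-at = z , final , path z (k , x≡)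
    where
    c : Fin n
    -- With `d = suc d-1`, the bound `d ≤ n` unfolds to `d-1 < n`, so `c` is the index of the cycle
    -- of period `d`.
    c = fromℕ< d≤n
    -- `s` is the number of steps made since the cycle was entered, and `k` the rounds completed in
    -- them.
    s = x ∸ suc m
    k = s / ℓ c
    z : State
    z = inj₂ (c , s mod ℓ c)
    x≡ : x ≡ suc m + toℕ (s mod ℓ c) + k * ℓ c
    x≡ = begin
      x                                          ≡⟨ m+[n∸m]≡n (≰⇒> x≰m) ⟨
      suc m + s                                  ≡⟨ cong (suc m +_) (m≡m%n+[m/n]*n s (ℓ c)) ⟩
      suc m + (s % ℓ c + k * ℓ c)                ≡⟨ +-assoc (suc m) _ _ ⟨
      suc m + s % ℓ c + k * ℓ c                  ≡⟨ cong (λ r → suc m + r + k * ℓ c) (toℕ-mod s (ℓ c)) ⟨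
      suc m + toℕ (s mod ℓ c) + k * ℓ c          ∎
      where open ≡-Reasoning
    ℓ≡d : ℓ c ≡ d
    ℓ≡d = cong suc (Fin.toℕ-fromℕ< d≤n)
    final : Final z
    final = subst (λ e → Pumpable e (suc m + toℕ (s mod ℓ c))) (sym ℓ≡d)
      (pumpable-at k (≤-trans (n≤1+n m) (m≤m+n (suc m) _))
        (trans (cong (λ e → suc m + toℕ (s mod ℓ c) + k * e) (sym ℓ≡d)) (sym x≡)))

  size : ∣Q∣ B ≤ 4 * n ^ 2
  size = begin
    -- The single extra tail state is absorbed by `1 ≤ n * n`, as `n` is positive; the cycles take
    -- at most another `n * n`.
    suc m + proj₁ cycles       ≤⟨ +-mono-≤ (+-monoˡ-≤ m (*-mono-≤ n>0 n>0)) (proj₂ (proj₂ cycles)) ⟩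
    n * n + m + n * n          ≡⟨ total n ⟩
    4 * n ^ 2                  ∎
    where
    open ≤-Reasoning
    total : ∀ n → n * n + 2 * (n * n) + n * n ≡ 4 * (n * (n * 1))
    total = solve-∀

theorem1 : Σ[ c ∈ ℕ ] ((A : UnaryNFA) →
    Σ[ B ∈ UnaryNFA ] (L B ≐ L A) ×
    (Σ[ B-chrobak ∈ ChrobakNormalForm B ]
    (∣Q∣ B ≤ c * ∣Q∣ A ^ 2) × (∀ i → period B-chrobak i ≤ ∣Q∣ A)))
theorem1 = 4 , λ A → let open Construction A in B , (sound , complete) , B-chrobak , size , Fin.toℕ<n
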